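{- Suppose $(X,d)$ is a separable uniform metric space without isolated points, with a uniformly distributed measure $\mu$ such that $\mu(X)<\infty$. Let $G=(V,E)$ be a g.e.c. graph on a dense subset $V$ of $X$. Suppose $\mu$ satisfies $$\lim_{\epsilon\in\mathbb{Q},\,\epsilon\to0}|\mu(B_1(x))-\mu(B_{1+\epsilon}(x))|=0$$ for any (equivalently, some) $x\in V$, and the family $\mathcal{S}:=\{B_{1+\epsilon}(v): v\in V,\ \epsilon\in(-1,1)\cap\mathbb{Q}\}$ is of finite VC-dimension. Then $$\alpha(G)=1/Vl_\mu(X).$$
   Context: $B_r(x)$ denotes the open ball of radius $r$ around $x$. For a graph $G=(V,E)$ and $v\in V$, $N_1(v)$ is the set of vertices adjacent to $v$, and $$\alpha(G):=\inf_{U\subseteq_{\mathrm{fin}}V}\ \sup_{v\in V}\frac{|N_1(v)\cap U|}{|U|}\in[0,1],$$ where $U$ ranges over non-empty finite subsets of $V$. A metric space $(X,d)$ is uniform if there is a uniformly distributed measure $\mu$ on it, i.e. a (Borel) measure with $0<\mu(B_r(x))=\mu(B_r(y))<\infty$ for all real $r>0$ and $x,y\in X$. Its ball volume is $Vl_\mu(X):=\mu(X)/\mu(B_1(x))$ for some (any) $x\in X$. VC-dimension: for a family $\mathcal{F}$ of subsets of $X$, a set $A\subseteq X$ is shattered by $\mathcal{F}$ if every subset of $A$ has the form $F\cap A$ with $F\in\mathcal{F}$; the VC-dimension of $\mathcal{F}$ is the smallest $n$ such that no subset of $X$ of size $n+1$ is shattered (infinite if no such $n$ exists). A (simple, undirected)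 graph $G$ with vertex set a dense $V\subseteq X$ is g.e.c. if (i) any two adjacent $u,v\in V$ satisfy $d(u,v)<1$; and (ii) for any $s\in V$, any disjoint finite $A,B\subseteq V$ contained in $B_1(s)$, and any $\epsilon>0$, there is $v\in V\setminus(A\cup B)$ with $d(s,v)<\epsilon$ adjacent to every vertex in $A$ and to no vertex in $B$. -}

module Defs where

open import Algebra.Bundles using (CommutativeRing)
import Algebra.Construct.NaturalChoice.Max as Max
import Algebra.Definitions.RawMonoid as RawMonoid
import Algebra.Properties.AbelianGroup as AbelianGroupProperties
import Algebra.Properties.Ring as RingProperties
open import Axiom.ExcludedMiddle using (ExcludedMiddle)
open import Data.Empty using (⊥-elim)
open import Data.Integer.Base using (ℤ; +_; -[1+_])
open import Data.List.Base using (List; []; _∷_; length; filter)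
open import Data.List.Properties using (length-filter)
open import Data.List.Relation.Unary.All as All using (All)
import Data.List.Membership.Setoid as Membership
import Data.List.Relation.Binary.Disjoint.Setoid as Disjointness
import Data.List.Relation.Unary.AllPairs as AllPairs
import Data.List.Relation.Unary.Unique.Setoid as Uniqueness
open import Data.Maybe.Base using (zipWith)
import Data.Nat.Base as ℕ
open ℕ using (ℕ; zero; suc)
open import Data.Product using (Σ; Σ-syntax; ∃; ∃-syntax; _×_; _,_; proj₁; proj₂)
open import Data.Rational.Base as ℚ using (ℚ; 0ℚ; 1ℚ)
open import Data.Sum.Base using (inj₁; inj₂)
open import Function.Definitions using (Injective)
open import Function.Metric.Structures using (IsGeneralMetric)
open import Level using (0ℓ)
open import Relation.Binary.Bundles using (Setoid; TotalOrder)
open import Relation.Binary.Core using (Rel)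
open import Relation.Binary.Definitions using (Irreflexive; Symmetric; _Respects₂_)
open import Relation.Binary.PropositionalEquality using (_≡_; _≢_; refl)
open import Relation.Binary.Structures using (IsTotalOrder)
import Relation.Binary.Construct.Add.Supremum.Equality as SupEquality
import Relation.Binary.Construct.Add.Supremum.NonStrict as SupNonStrict
import Relation.Binary.Construct.Add.Supremum.Strict as SupStrict
import Relation.Binary.Construct.NonStrictToStrict as ToStrict
open import Relation.Nullary using (¬_)
open import Relation.Nullary.Construct.Add.Supremum using (_⁺; ⊤⁺; [_])
open import Relation.Unary using (Pred; _∈_; _⊆_; _≐_; _∩_; ∁; ⋃; Empty; Satisfiable; U)

record IsLUB {A I : Set} (_≤_ : Rel A 0ℓ) (f : I → A) (s : A) : Set where
  field
    upper : ∀ i → f i ≤ s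
    least : ∀ b → (∀ i → f i ≤ b) → s ≤ b

-- Complete ordered fields are unique up to isomorphism, so "for every
-- ℝ : CompleteOrderedField" is the usual axiomatic treatment of the reals.
-- Equality is a setoid equality because Agda has no quotients.
-- The value of 0# ⁻¹ is unspecified.
record CompleteOrderedField : Set₁ where
  infix 4 _≤_
  infix 8 _⁻¹
  field
    commutativeRing : CommutativeRing 0ℓ 0ℓ

  open CommutativeRing commutativeRing public

  field
    _≤_          : Rel Carrier 0ℓ
    isTotalOrder : IsTotalOrder _≈_ _≤_
    +-monoˡ-≤    : ∀ z {x y} → x ≤ y → x + z ≤ y + z
    *-nonNeg     : ∀ {x y} → 0# ≤ x → 0# ≤ y → 0# ≤ x * y
    0≉1          : ¬ (0# ≈ 1#)
    _⁻¹          : Carrier → Carrier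
    *-inverseʳ   : ∀ {x} → ¬ (x ≈ 0#) → x * x ⁻¹ ≈ 1#
    complete     : ∀ {I : Set} (f : I → Carrier) → I →
                   (∃[ b ] ∀ i → f i ≤ b) → ∃[ s ] IsLUB _≤_ f s

  totalOrder : TotalOrder 0ℓ 0ℓ 0ℓ
  totalOrder = record { isTotalOrder = isTotalOrder }

  open IsTotalOrder isTotalOrder public
    using (total; antisym; ≤-respˡ-≈; ≤-respʳ-≈)
    renaming (refl to ≤-refl; reflexive to ≤-reflexive; trans to ≤-trans)

  open ToStrict _≈_ _≤_ public using (_<_)
  open Max totalOrder public using (_⊔_)

  ∣_∣ : Carrier → Carrier
  ∣ x ∣ = x ⊔ (- x)

  fromℕ : ℕ → Carrier
  fromℕ n = RawMonoid._×_ +-rawMonoid n 1#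

  fromℤ : ℤ → Carrier
  fromℤ (+ n)    = fromℕ n
  fromℤ -[1+ n ] = - fromℕ (suc n)

  fromℚ : ℚ → Carrier
  fromℚ q = fromℤ (ℚ.↥ q) * fromℤ (ℚ.↧ q) ⁻¹

  open RingProperties ring using (-‿distribʳ-*)
  open AbelianGroupProperties +-abelianGroup using (⁻¹-involutive; ∙-cancelʳ)

  neg-antimono : ∀ {x y} → x ≤ y → - y ≤ - x
  neg-antimono {x} {y} x≤y =
    ≤-respˡ-≈ (lemma x y) (≤-respʳ-≈ (trans (+-congˡ (+-comm (- x) (- y))) (lemma y x))
      (+-monoˡ-≤ (- x + - y) x≤y))
    where
    lemma : ∀ a b → a + (- a + - b) ≈ - b
    lemma a b = trans (sym (+-assoc a (- a) (- b)))
      (trans (+-congʳ (-‿inverseʳ a)) (+-identityˡ (- b)))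

  -0≈0 : - 0# ≈ 0#
  -0≈0 = trans (sym (+-identityˡ (- 0#))) (-‿inverseʳ 0#)

  neg-nonNeg : ∀ {x} → x ≤ 0# → 0# ≤ - x
  neg-nonNeg x≤0 = ≤-respˡ-≈ -0≈0 (neg-antimono x≤0)

  neg-nonNeg⁻ : ∀ {x} → 0# ≤ - x → x ≤ 0#
  neg-nonNeg⁻ 0≤-x = ≤-respˡ-≈ (⁻¹-involutive _) (≤-respʳ-≈ -0≈0 (neg-antimono 0≤-x))

  0≤1 : 0# ≤ 1#
  0≤1 with total 0# 1#
  ... | inj₁ 0≤1 = 0≤1
  ... | inj₂ 1≤0 = ≤-respʳ-≈
    (trans (sym (-‿distribʳ-* (- 1#) 1#)) (trans (-‿cong (*-identityʳ (- 1#))) (⁻¹-involutive 1#)))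
    (*-nonNeg (neg-nonNeg 1≤0) (neg-nonNeg 1≤0))

  0<1 : 0# < 1#
  0<1 = 0≤1 , 0≉1

  1≰0 : ¬ (1# ≤ 0#)
  1≰0 1≤0 = 0≉1 (antisym 0≤1 1≤0)

  ⁻¹-nonNeg : ∀ {x} → 0# ≤ x → ¬ (x ≈ 0#) → 0# ≤ x ⁻¹
  ⁻¹-nonNeg {x} 0≤x x≉0 with total 0# (x ⁻¹)
  ... | inj₁ p = p
  ... | inj₂ p = ⊥-elim (1≰0 (neg-nonNeg⁻ (≤-respʳ-≈
    (trans (sym (-‿distribʳ-* x (x ⁻¹))) (-‿cong (*-inverseʳ x≉0)))
    (*-nonNeg 0≤x (neg-nonNeg p)))))

  *-monoʳ-≤ : ∀ {x y z} → 0# ≤ z → x ≤ y → x * z ≤ y * z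
  *-monoʳ-≤ {x} {y} {z} 0≤z x≤y =
    ≤-respˡ-≈ (+-identityˡ _) (≤-respʳ-≈ cancel (+-monoˡ-≤ (x * z)
      (*-nonNeg (≤-respˡ-≈ (-‿inverseʳ x) (+-monoˡ-≤ (- x) x≤y)) 0≤z)))
    where
    cancel : (y + - x) * z + x * z ≈ y * z
    cancel = trans (sym (distribʳ z (y + - x) x)) (*-congʳ
      (trans (+-assoc y (- x) x) (trans (+-congˡ (-‿inverseˡ x)) (+-identityʳ y))))

  x≤1+x : ∀ x → x ≤ 1# + x
  x≤1+x x = ≤-respˡ-≈ (+-identityˡ x) (+-monoˡ-≤ x 0≤1)

  fromℕ-nonNeg : ∀ n → 0# ≤ fromℕ n
  fromℕ-nonNeg zero    = ≤-refl
  fromℕ-nonNeg (suc n) = ≤-trans (fromℕ-nonNeg n) (x≤1+x (fromℕ n))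

  fromℕ-mono : ∀ {m n} → m ℕ.≤ n → fromℕ m ≤ fromℕ n
  fromℕ-mono {n = n} ℕ.z≤n = fromℕ-nonNeg n
  fromℕ-mono (ℕ.s≤s {m} {n} m≤n) = ≤-respˡ-≈ (+-comm (fromℕ m) 1#)
    (≤-respʳ-≈ (+-comm (fromℕ n) 1#) (+-monoˡ-≤ 1# (fromℕ-mono m≤n)))

  fromℕ-suc≉0 : ∀ n → ¬ (fromℕ (suc n) ≈ 0#)
  fromℕ-suc≉0 n eq = 1≰0 (≤-respʳ-≈ eq
    (≤-respˡ-≈ (+-identityʳ 1#) (fromℕ-mono {1} {suc n} (ℕ.s≤s ℕ.z≤n))))

  +-monoˡ-< : ∀ z {x y} → x < y → x + z < y + z
  +-monoˡ-< z (x≤y , x≉y) = +-monoˡ-≤ z x≤y , λ eq → x≉y (∙-cancelʳ z _ _ eq)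

  ≤-<-trans : ∀ {x y z} → x ≤ y → y < z → x < z
  ≤-<-trans x≤y (y≤z , y≉z) = ≤-trans x≤y y≤z , λ x≈z → y≉z (antisym y≤z (≤-respˡ-≈ x≈z x≤y))

  <-respʳ-≈ : ∀ {x y z} → y ≈ z → x < y → x < z
  <-respʳ-≈ y≈z (x≤y , x≉y) = ≤-respʳ-≈ y≈z x≤y , λ x≈z → x≉y (trans x≈z (sym y≈z))

  <-respˡ-≈ : ∀ {x y z} → y ≈ z → y < x → z < x
  <-respˡ-≈ y≈z (y≤x , y≉x) = ≤-respˡ-≈ y≈z y≤x , λ z≈x → y≉x (trans y≈z z≈x)

  sup : {I : Set} (f : I → Carrier) → I → (∃[ b ] ∀ i → f i ≤ b) → Carrier
  sup f i b = proj₁ (complete f i b)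

  inf : {I : Set} (f : I → Carrier) → I → (∃[ b ] ∀ i → b ≤ f i) → Carrier
  inf f i (b , b≤) = - sup (λ j → - f j) i (- b , λ j → neg-antimono (b≤ j))

  -- [0,∞] is carried by the nonnegative part of Carrier ⁺, with ⊤⁺ as ∞.

  open SupEquality _≈_ public using (_≈⁺_)
  open SupNonStrict _≤_ public using (_≤⁺_)
  open SupStrict _<_ public using (_<⁺_)

  _+⁺_ : Carrier ⁺ → Carrier ⁺ → Carrier ⁺
  _+⁺_ = zipWith _+_

  partialSum : (ℕ → Carrier ⁺) → ℕ → Carrier ⁺
  partialSum f zero    = [ 0# ]
  partialSum f (suc n) = partialSum f n +⁺ f n

  finiteValue : (x : Carrier ⁺) → x <⁺ ⊤⁺ → Carrier
  finiteValue [ x ] _ = x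

  _/⁺_ : Carrier ⁺ → Carrier → Carrier ⁺
  [ x ] /⁺ y = [ x * y ⁻¹ ]
  ⊤⁺    /⁺ y = ⊤⁺

  -- 1/∞ = 0
  1/⁺_ : Carrier ⁺ → Carrier
  1/⁺ [ x ] = x ⁻¹
  1/⁺ ⊤⁺    = 0#

record MetricSpace (ℝ : CompleteOrderedField) : Set₁ where
  private module ℝ = CompleteOrderedField ℝ
  infix 4 _≈_
  field
    Carrier  : Set
    _≈_      : Rel Carrier 0ℓ
    d        : Carrier → Carrier → ℝ.Carrier
    isMetric : IsGeneralMetric _≈_ ℝ._≈_ ℝ._≤_ ℝ.0# ℝ._+_ d

  open IsGeneralMetric isMetric public using (≈-isEquivalence; triangle)

  setoid : Setoid 0ℓ 0ℓ
  setoid = record { isEquivalence = ≈-isEquivalence }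

module _ {ℝ : CompleteOrderedField} (X : MetricSpace ℝ) where
  private
    module ℝ = CompleteOrderedField ℝ
    module X = MetricSpace X
  open ℝ using (0#; 1#; _<_; _≤⁺_; _≈⁺_)

  -- Only predicates respecting X._≈_ represent subsets of X.
  Extensional : Pred X.Carrier 0ℓ → Set
  Extensional A = ∀ {x y} → x X.≈ y → A x → A y

  Ball : ℝ.Carrier → X.Carrier → Pred X.Carrier 0ℓ
  Ball r x y = X.d x y < r

  IsOpen : Pred X.Carrier 0ℓ → Set
  IsOpen A = ∀ x → x ∈ A → ∃[ r ] 0# < r × Ball r x ⊆ A

  Dense : Pred X.Carrier 0ℓ → Set
  Dense A = ∀ x r → 0# < r → ∃[ a ] a ∈ A × a ∈ Ball r x

  Countable : Pred X.Carrier 0ℓ → Set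
  Countable A = ∃[ code ] Injective (λ (a b : Σ X.Carrier A) → proj₁ a X.≈ proj₁ b) (_≡_ {A = ℕ}) code

  Separable : Set₁
  Separable = ∃[ A ] Extensional A × Countable A × Dense A

  Isolated : Pred X.Carrier 0ℓ
  Isolated x = ∃[ r ] 0# < r × (∀ y → y ∈ Ball r x → x X.≈ y)

  NoIsolatedPoints : Set
  NoIsolatedPoints = Empty Isolated

  dense⇒satisfiable : ∀ {A} → Dense A → X.Carrier → Satisfiable A
  dense⇒satisfiable dense x with dense x 1# ℝ.0<1
  ... | a , a∈A , _ = a , a∈A

  data Borel : Pred X.Carrier 0ℓ → Set₁ where
    open-set   : ∀ {A} → IsOpen A → Borel A
    complement : ∀ {A} → Borel A → Borel (∁ A)
    union      : ∀ {A : ℕ → Pred X.Carrier 0ℓ} → (∀ n → Borel (A n)) → Borel (⋃ ℕ A)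
    resp-≐     : ∀ {A B} → A ≐ B → Borel A → Borel B

  record BorelMeasure : Set₁ where
    field
      μ        : (A : Pred X.Carrier 0ℓ) → Borel A → ℝ.Carrier ⁺
      μ-cong   : ∀ {A B} (a : Borel A) (b : Borel B) → A ≐ B → μ A a ≈⁺ μ B b
      μ-nonNeg : ∀ {A} (a : Borel A) → [ 0# ] ≤⁺ μ A a
      μ-empty  : ∀ {A} (a : Borel A) → Empty A → μ A a ≈⁺ [ 0# ]
      μ-union  : ∀ {A : ℕ → Pred X.Carrier 0ℓ} (a : ∀ n → Borel (A n)) →
                 (∀ m n → m ≢ n → Empty (A m ∩ A n)) →
                 IsLUB _≤⁺_ (ℝ.partialSum (λ n → μ (A n) (a n))) (μ (⋃ ℕ A) (union a))

  open Membership X.setoid public using () renaming (_∈_ to _∈ₗ_; _∉_ to _∉ₗ_)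
  open Disjointness X.setoid using (Disjoint)
  open Uniqueness X.setoid using (Unique)

  -- A finite subset of A, listed without repetition.
  record FiniteSubset (A : Pred X.Carrier 0ℓ) : Set where
    field
      elements : List X.Carrier
      unique   : Unique elements
      inside   : All A elements

  open FiniteSubset

  record Graph : Set₁ where
    infix 4 _~_
    field
      V        : Pred X.Carrier 0ℓ
      V-ext    : Extensional V
      _~_      : Rel X.Carrier 0ℓ
      ~-resp   : _~_ Respects₂ X._≈_
      ~-irrefl : Irreflexive X._≈_ _~_
      ~-sym    : Symmetric _~_
      ~⇒V      : ∀ {u v} → u ~ v → u ∈ V

  record IsGEC (G : Graph) : Set where
    open Graph G
    field
      adjacent⇒close : ∀ {u v} → u ~ v → X.d u v < 1#
      extension      : ∀ s → s ∈ V → (A B : FiniteSubset V) →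
                       Disjoint (elements A) (elements B) →
                       All (Ball 1# s) (elements A) → All (Ball 1# s) (elements B) →
                       ∀ ε → 0# < ε →
                       ∃[ v ] v ∈ V × v ∉ₗ elements A × v ∉ₗ elements B × X.d s v < ε ×
                              All (λ a → v ~ a) (elements A) × All (λ b → ¬ (v ~ b)) (elements B)

  module _ {I : Set} (F : I → Pred X.Carrier 0ℓ) where

    Shattered : Pred X.Carrier 0ℓ → Set₁
    Shattered A = ∀ C → Extensional C → C ⊆ A → ∃[ i ] (F i ∩ A) ≐ C

    NoneShattered : ℕ → Set₁
    NoneShattered k = ∀ (A : FiniteSubset U) → length (elements A) ≡ k →
                      ¬ Shattered (_∈ₗ elements A)

    IsVCDimension : ℕ → Set₁
    IsVCDimension n = NoneShattered (suc n) × (∀ m → m ℕ.< n → ¬ NoneShattered (suc m))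

    HasFiniteVCDimension : Set₁
    HasFiniteVCDimension = ∃[ n ] IsVCDimension n

  -- {B₁₊ε(v) : v ∈ A, ε ∈ (-1,1) ∩ ℚ}
  perturbedUnitBalls : (A : Pred X.Carrier 0ℓ) →
                  (Σ X.Carrier A × Σ[ ε ∈ ℚ ] (ℚ.- 1ℚ ℚ.< ε × ε ℚ.< 1ℚ)) → Pred X.Carrier 0ℓ
  perturbedUnitBalls A ((v , _) , (ε , _)) = Ball (1# ℝ.+ ℝ.fromℚ ε) v

module _ {ℝ : CompleteOrderedField} {X : MetricSpace ℝ} where
  private
    module ℝ = CompleteOrderedField ℝ
    module X = MetricSpace X
  open ℝ using (0#; 1#; _+_; _-_; _*_; _⁻¹; _<_; _≤_; _<⁺_; _≈⁺_; _/⁺_; ∣_∣; fromℕ; fromℚ; finiteValue)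

  ball-open : ∀ r x → IsOpen X (Ball X r x)
  ball-open r x y dxy<r = r - X.d x y , 0<r-dxy , λ {z} dyz<r-dxy →
    ℝ.≤-<-trans (X.triangle x y z)
      (ℝ.<-respˡ-≈ (ℝ.+-comm _ _) (ℝ.<-respʳ-≈ cancel (ℝ.+-monoˡ-< (X.d x y) dyz<r-dxy)))
    where
    0<r-dxy : 0# < r - X.d x y
    0<r-dxy = ℝ.<-respˡ-≈ (ℝ.-‿inverseʳ (X.d x y)) (ℝ.+-monoˡ-< (ℝ.- X.d x y) dxy<r)
    cancel : (r - X.d x y) + X.d x y ℝ.≈ r
    cancel = ℝ.trans (ℝ.+-assoc _ _ _) (ℝ.trans (ℝ.+-congˡ (ℝ.-‿inverseˡ _)) (ℝ.+-identityʳ r))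

  U-open : IsOpen X U
  U-open x _ = 1# , ℝ.0<1 , λ _ → _

  module _ (M : BorelMeasure X) where
    open BorelMeasure M

    μBall : ℝ.Carrier → X.Carrier → ℝ.Carrier ⁺
    μBall r x = μ (Ball X r x) (open-set (ball-open r x))

    μX : ℝ.Carrier ⁺
    μX = μ U (open-set U-open)

    record IsUniformlyDistributed : Set where
      field
        ball-positive : ∀ r → 0# < r → ∀ x → [ 0# ] <⁺ μBall r x
        ball-equal    : ∀ r → 0# < r → ∀ x y → μBall r x ≈⁺ μBall r y
        ball-finite   : ∀ r → 0# < r → ∀ x → μBall r x <⁺ ⊤⁺

  module _ {M : BorelMeasure X} (ud : IsUniformlyDistributed M) where
    open IsUniformlyDistributed ud

    ballVolume : (r : ℝ.Carrier) → 0# < r → X.Carrier → ℝ.Carrier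
    ballVolume r 0<r x = finiteValue (μBall M r x) (ball-finite r 0<r x)

    Vl : X.Carrier → ℝ.Carrier ⁺
    Vl x = μX M /⁺ ballVolume 1# ℝ.0<1 x

    -- lim |μ(B₁(x)) − μ(B₁₊ε(x))| = 0 as ε → 0 through ℚ.  Only the ε with
    -- 1 + ε > 0, which include all sufficiently small ones, are considered,
    -- so that both ball volumes are known to be finite.
    BallVolumeContinuousAt1 : X.Carrier → Set
    BallVolumeContinuousAt1 x =
      ∀ η → 0# < η → ∃[ δ ] 0# < δ ×
      (∀ (ε : ℚ) (0<1+ε : 0# < 1# + fromℚ ε) → ε ≢ 0ℚ → ∣ fromℚ ε ∣ < δ →
       ∣ ballVolume 1# ℝ.0<1 x - ballVolume (1# + fromℚ ε) 0<1+ε x ∣ < η)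

  module _ (em : ExcludedMiddle 0ℓ) (G : Graph X) where
    open Graph G
    open FiniteSubset

    NonemptyFiniteSubset : Set
    NonemptyFiniteSubset = Σ[ W ∈ FiniteSubset X V ] elements W ≢ []

    -- |N₁(v) ∩ W|; counting needs adjacency to be decided classically.
    degreeInto : FiniteSubset X V → X.Carrier → ℕ
    degreeInto W v = length (filter (λ w → em {v ~ w}) (elements W))

    density : FiniteSubset X V → X.Carrier → ℝ.Carrier
    density W v = fromℕ (degreeInto W v) * fromℕ (length (elements W)) ⁻¹

    size≉0 : (W : NonemptyFiniteSubset) → ¬ (fromℕ (length (elements (proj₁ W))) ℝ.≈ 0#)
    size≉0 (W , W≢[]) with elements W
    ... | []     = ⊥-elim (W≢[] refl)
    ... | _ ∷ ws = ℝ.fromℕ-suc≉0 (length ws)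

    size⁻¹-nonNeg : (W : NonemptyFiniteSubset) → 0# ≤ fromℕ (length (elements (proj₁ W))) ⁻¹
    size⁻¹-nonNeg W = ℝ.⁻¹-nonNeg (ℝ.fromℕ-nonNeg (length (elements (proj₁ W)))) (size≉0 W)

    0≤density : (W : NonemptyFiniteSubset) (v : X.Carrier) → 0# ≤ density (proj₁ W) v
    0≤density W v = ℝ.*-nonNeg (ℝ.fromℕ-nonNeg (degreeInto (proj₁ W) v)) (size⁻¹-nonNeg W)

    density≤1 : (W : NonemptyFiniteSubset) (v : X.Carrier) → density (proj₁ W) v ≤ 1#
    density≤1 W v = ℝ.≤-respʳ-≈ (ℝ.*-inverseʳ (size≉0 W))
      (ℝ.*-monoʳ-≤ (size⁻¹-nonNeg W)
        (ℝ.fromℕ-mono (length-filter (λ w → em {v ~ w}) (elements (proj₁ W)))))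

    module _ (V-inhabited : Satisfiable V) where

      supDensity : NonemptyFiniteSubset → ℝ.Carrier
      supDensity W = ℝ.sup {I = Σ X.Carrier V} (λ v → density (proj₁ W) (proj₁ v)) V-inhabited
        (1# , λ v → density≤1 W (proj₁ v))

      0≤supDensity : ∀ W → 0# ≤ supDensity W
      0≤supDensity W = ℝ.≤-trans (0≤density W (proj₁ V-inhabited))
        (IsLUB.upper (proj₂ (ℝ.complete _ V-inhabited _)) V-inhabited)

      singletonVertex : NonemptyFiniteSubset
      singletonVertex = record
        { elements = proj₁ V-inhabited ∷ []
        ; unique   = All.[] AllPairs.∷ AllPairs.[]
        ; inside   = proj₂ V-inhabited All.∷ All.[]
        } , λ ()

      α : ℝ.Carrier
      α = ℝ.inf supDensity singletonVertex (0# , 0≤supDensity)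

{-# OPTIONS --safe #-}
module Submission where

open import Defs
import Algebra.Properties.AbelianGroup as AbelianGroupProperties
import Algebra.Properties.Semiring.Mult as Mult
import Algebra.Solver.Ring.NaturalCoefficients.Default as NaturalCoefficients
open import Axiom.ExcludedMiddle using (ExcludedMiddle)
open import Data.Empty using (⊥-elim)
open import Data.Integer.Base using (+_)
open import Data.List.Base using (List; []; _∷_; _++_; length; filter)
open import Data.List.Membership.Setoid.Properties using (∈-filter⁺)
open import Data.List.Properties
  using (filter-accept; filter-reject; filter-none; filter-++; length-++; length-filter)
open import Data.List.Relation.Unary.All as All using (All; []; _∷_)
import Data.List.Relation.Unary.All.Properties as AllProperties
open AllProperties using (¬Any⇒All¬)
open import Data.List.Relation.Unary.AllPairs using (AllPairs; []; _∷_)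
import Data.List.Relation.Unary.AllPairs.Properties as AllPairsProperties
open import Data.List.Relation.Unary.Any as Any using (Any)
open import Data.List.Relation.Unary.Any.Properties using (¬Any[])
open import Data.Nat.Base as ℕ using (ℕ; zero; suc)
import Data.Nat.Coprimality as Coprimality
import Data.Nat.Properties as ℕ
open import Data.Product using (∃-syntax; _×_; _,_; proj₁; proj₂)
open import Data.Rational.Base using (mkℚ; 0ℚ)
open import Data.Sum.Base using (_⊎_; inj₁; inj₂; [_,_]′)
open import Function.Base using (id; _∘_)
open import Function.Metric.Structures using (IsGeneralMetric)
open import Level using (0ℓ)
open import Relation.Binary.Bundles using (TotalOrder)
import Relation.Binary.Construct.Add.Supremum.Equality as SupEquality
import Relation.Binary.Construct.Add.Supremum.NonStrict as SupNonStrict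
import Relation.Binary.Construct.Add.Supremum.Strict as SupStrict
import Relation.Binary.Construct.NonStrictToStrict as ToStrict
open import Relation.Binary.PropositionalEquality as ≡ using (_≡_; _≢_)
import Relation.Binary.Reasoning.PartialOrder as PartialOrderReasoning
open import Relation.Nullary using (¬_; Dec; yes; no)
open import Relation.Nullary.Construct.Add.Supremum using (⊤⁺; [_])
open import Relation.Nullary.Decidable using (decidable-stable; toSum)
open import Relation.Unary
  using (Pred; _⊆_; _≐_; _∩_; _∪_; ∁; ⋃; ∅; Empty; Satisfiable; U; Decidable)

-- Write T = μ(X) and b = μ(B₁).  Lower bound: integrating |B₁(y) ∩ W| over y
-- gives |W| b, so some y has |B₁(y) ∩ W| ≥ |W| b / T; as the balls are open, a
-- vertex s near y also has these points in B₁(s), and the extension property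
-- yields a vertex adjacent to all of them.
--
-- Upper bound: equal positive ball measures and T < ∞ make X totally bounded by
-- packing.  Cut X into finitely many small cells and let W contain ⌈μ(C)/c⌉
-- vertices next to each cell C.  A cell whose vertices meet N₁(v) lies in
-- B₁₊ε(v), so |N₁(v) ∩ W| c exceeds μ(B₁₊ε) by at most c for each cell,
-- uniformly in v, while |W| c ≥ T.  Let c → 0, then ε → 0.

-- Arithmetic, order and the Archimedean property of the reals.

module RealProperties (em : ∀ {ℓ} → ExcludedMiddle ℓ) (ℝ : CompleteOrderedField) where
  open CompleteOrderedField ℝ hiding (zero)
  open AbelianGroupProperties +-abelianGroup using (⁻¹-involutive)
  open Mult semiring using (×-homo-+)
  open NaturalCoefficients commutativeSemiring using (solve; _:+_; _:*_; _:=_; con)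
  open PartialOrderReasoning (TotalOrder.poset totalOrder) public

  <⇒≱ : ∀ {x y} → x < y → ¬ (y ≤ x)
  <⇒≱ = ToStrict.<⇒≱ _≈_ _≤_ antisym

  ≰⇒> : ∀ {x y} → ¬ (x ≤ y) → y < x
  ≰⇒> = ToStrict.≰⇒> _≈_ _≤_ sym ≤-reflexive total

  ≮⇒≥ : ∀ {x y} → ¬ (x < y) → y ≤ x
  ≮⇒≥ = ToStrict.≮⇒≥ _≈_ _≤_ sym (λ _ _ → em) ≤-reflexive total

  <-≤-trans : ∀ {x y z} → x < y → y ≤ z → x < z
  <-≤-trans = ToStrict.<-≤-trans _≈_ _≤_ sym ≤-trans antisym ≤-respʳ-≈

  +-monoʳ-≤ : ∀ z {x y} → x ≤ y → z + x ≤ z + y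
  +-monoʳ-≤ z {x} {y} x≤y = begin
    z + x ≈⟨ +-comm z x ⟩
    x + z ≤⟨ +-monoˡ-≤ z x≤y ⟩
    y + z ≈⟨ +-comm y z ⟩
    z + y ∎

  +-mono-≤ : ∀ {x y u v} → x ≤ y → u ≤ v → x + u ≤ y + v
  +-mono-≤ x≤y u≤v = ≤-trans (+-monoˡ-≤ _ x≤y) (+-monoʳ-≤ _ u≤v)

  +-mono-<-≤ : ∀ {x y u v} → x < y → u ≤ v → x + u < y + v
  +-mono-<-≤ x<y u≤v = <-≤-trans (+-monoˡ-< _ x<y) (+-monoʳ-≤ _ u≤v)

  *-monoˡ-≤ : ∀ {x y z} → 0# ≤ z → x ≤ y → z * x ≤ z * y
  *-monoˡ-≤ {x} {y} {z} 0≤z x≤y = begin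
    z * x ≈⟨ *-comm z x ⟩
    x * z ≤⟨ *-monoʳ-≤ 0≤z x≤y ⟩
    y * z ≈⟨ *-comm y z ⟩
    z * y ∎

  x-y+y≈x : ∀ x y → (x - y) + y ≈ x
  x-y+y≈x x y = trans (+-assoc x (- y) y) (trans (+-congˡ (-‿inverseˡ y)) (+-identityʳ x))

  x+y-y≈x : ∀ x y → (x + y) - y ≈ x
  x+y-y≈x x y = trans (+-assoc x y (- y)) (trans (+-congˡ (-‿inverseʳ y)) (+-identityʳ x))

  x+y≤z⇒x≤z-y : ∀ {x y z} → x + y ≤ z → x ≤ z - y
  x+y≤z⇒x≤z-y {x} {y} x+y≤z = ≤-respˡ-≈ (x+y-y≈x x y) (+-monoˡ-≤ (- y) x+y≤z)

  x≤z-y⇒x+y≤z : ∀ {x y z} → x ≤ z - y → x + y ≤ z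
  x≤z-y⇒x+y≤z {y = y} {z} x≤z-y = ≤-respʳ-≈ (x-y+y≈x z y) (+-monoˡ-≤ y x≤z-y)

  x<y⇒0<y-x : ∀ {x y} → x < y → 0# < y - x
  x<y⇒0<y-x {x} x<y = <-respˡ-≈ (-‿inverseʳ x) (+-monoˡ-< (- x) x<y)

  x<x+y : ∀ x {y} → 0# < y → x < x + y
  x<x+y x {y} 0<y = <-respˡ-≈ (+-identityˡ x) (<-respʳ-≈ (+-comm y x) (+-monoˡ-< x 0<y))

  x≤x+y : ∀ x {y} → 0# ≤ y → x ≤ x + y
  x≤x+y x 0≤y = ≤-respˡ-≈ (+-identityʳ x) (+-monoʳ-≤ x 0≤y)

  0<+ : ∀ {x y} → 0# < x → 0# < y → 0# < x + y
  0<+ {x} 0<x 0<y = <-≤-trans 0<x (x≤x+y x (proj₁ 0<y))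

  >⇒≉0 : ∀ {x} → 0# < x → ¬ (x ≈ 0#)
  >⇒≉0 (_ , 0≉x) x≈0 = 0≉x (sym x≈0)

  *-inverseˡ : ∀ {x} → ¬ (x ≈ 0#) → x ⁻¹ * x ≈ 1#
  *-inverseˡ {x} x≉0 = trans (*-comm (x ⁻¹) x) (*-inverseʳ x≉0)

  x*y*y⁻¹≈x : ∀ x {y} → ¬ (y ≈ 0#) → (x * y) * y ⁻¹ ≈ x
  x*y*y⁻¹≈x x y≉0 = trans (*-assoc _ _ _) (trans (*-congˡ (*-inverseʳ y≉0)) (*-identityʳ x))

  x*y⁻¹*y≈x : ∀ x {y} → ¬ (y ≈ 0#) → (x * y ⁻¹) * y ≈ x
  x*y⁻¹*y≈x x y≉0 = trans (*-assoc _ _ _) (trans (*-congˡ (*-inverseˡ y≉0)) (*-identityʳ x))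

  0<⁻¹ : ∀ {x} → 0# < x → 0# < x ⁻¹
  0<⁻¹ {x} 0<x = ⁻¹-nonNeg (proj₁ 0<x) x≉0 , λ 0≈x⁻¹ → 0≉1 (begin-equality
    0#        ≈⟨ zeroʳ x ⟨
    x * 0#    ≈⟨ *-congˡ 0≈x⁻¹ ⟩
    x * x ⁻¹  ≈⟨ *-inverseʳ x≉0 ⟩
    1#        ∎)
    where x≉0 = >⇒≉0 0<x

  0<* : ∀ {x y} → 0# < x → 0# < y → 0# < x * y
  0<* {x} {y} 0<x 0<y = *-nonNeg (proj₁ 0<x) (proj₁ 0<y) , λ 0≈xy → proj₂ 0<x (begin-equality
    0#               ≈⟨ zeroˡ (y ⁻¹) ⟨
    0# * y ⁻¹        ≈⟨ *-congʳ 0≈xy ⟩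
    (x * y) * y ⁻¹   ≈⟨ x*y*y⁻¹≈x x (>⇒≉0 0<y) ⟩
    x                ∎)

  *-cancelʳ-≤ : ∀ {x y z} → 0# < z → x * z ≤ y * z → x ≤ y
  *-cancelʳ-≤ {x} {y} {z} 0<z xz≤yz = begin
    x               ≈⟨ x*y*y⁻¹≈x x (>⇒≉0 0<z) ⟨
    (x * z) * z ⁻¹  ≤⟨ *-monoʳ-≤ (proj₁ (0<⁻¹ 0<z)) xz≤yz ⟩
    (y * z) * z ⁻¹  ≈⟨ x*y*y⁻¹≈x y (>⇒≉0 0<z) ⟩
    y               ∎

  ⁻¹-unique : ∀ {x y} → ¬ (y ≈ 0#) → x * y ≈ 1# → x ≈ y ⁻¹
  ⁻¹-unique {x} {y} y≉0 xy≈1 = begin-equality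
    x               ≈⟨ x*y*y⁻¹≈x x y≉0 ⟨
    (x * y) * y ⁻¹  ≈⟨ *-congʳ xy≈1 ⟩
    1# * y ⁻¹       ≈⟨ *-identityˡ _ ⟩
    y ⁻¹            ∎

  fromℕ-+ : ∀ m n → fromℕ (m ℕ.+ n) ≈ fromℕ m + fromℕ n
  fromℕ-+ = ×-homo-+ 1#

  fromℕ-suc-* : ∀ n x → fromℕ (suc n) * x ≈ fromℕ n * x + x
  fromℕ-suc-* n x = solve 2 (λ a b → (con 1 :+ a) :* b := a :* b :+ b) refl (fromℕ n) x

  0<fromℕ-suc : ∀ n → 0# < fromℕ (suc n)
  0<fromℕ-suc n = fromℕ-nonNeg (suc n) , λ eq → fromℕ-suc≉0 n (sym eq)

  -- Otherwise the multiples of `c` are bounded by `z` and have a supremum `s`. All of c, 2c, ...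
  -- lie below `s`, so `s - c` bounds every multiple as well, which contradicts `0# < c`.
  archimedean : ∀ {c} → 0# < c → ∀ z → ∃[ n ] z ≤ fromℕ n * c
  archimedean {c} 0<c z with em {P = ∃[ n ] z ≤ fromℕ n * c}
  ... | yes p = p
  ... | no ¬p with complete (λ n → fromℕ n * c) 0
                     (z , λ n → proj₁ (≰⇒> (λ z≤nc → ¬p (n , z≤nc))))
  ...   | s , lub = ⊥-elim (<⇒≱ (x<x+y s 0<c)
            (x≤z-y⇒x+y≤z (least _ λ n → x+y≤z⇒x≤z-y (≤-respˡ-≈ (fromℕ-suc-* n c) (upper (suc n))))))
    where open IsLUB lub

  -- Descends from an Archimedean multiple above `z` until the next smaller multiple is at most `z`.
  -- It fixes the number of vertices that a cell receives.
  ceiling : ∀ {c} → 0# < c → ∀ {z} → 0# ≤ z → ∃[ n ] z ≤ fromℕ n * c × fromℕ n * c ≤ z + c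
  ceiling {c} 0<c {z} 0≤z = let n , z≤nc = archimedean 0<c z in minimise n z≤nc
    where
    minimise : ∀ n → z ≤ fromℕ n * c → ∃[ n ] z ≤ fromℕ n * c × fromℕ n * c ≤ z + c
    minimise zero    z≤0 = zero , z≤0 , (begin
      0# * c  ≈⟨ zeroˡ c ⟩
      0#      ≤⟨ 0≤z ⟩
      z       ≤⟨ x≤x+y z (proj₁ 0<c) ⟩
      z + c   ∎)
    minimise (suc n) z≤[1+n]c with total z (fromℕ n * c)
    ... | inj₁ z≤nc = minimise n z≤nc
    ... | inj₂ nc≤z = suc n , z≤[1+n]c , (begin
      fromℕ (suc n) * c  ≈⟨ fromℕ-suc-* n c ⟩
      fromℕ n * c + c    ≤⟨ +-monoˡ-≤ c nc≤z ⟩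
      z + c              ∎)

  fraction : ∀ n {x} → 0# < x → ∃[ y ] 0# < y × fromℕ (suc n) * y ≈ x
  fraction n {x} 0<x = x * fromℕ (suc n) ⁻¹ , 0<* 0<x (0<⁻¹ (0<fromℕ-suc n)) ,
    trans (*-comm _ _) (x*y⁻¹*y≈x x (fromℕ-suc≉0 n))

  half : ∀ {x} → 0# < x → ∃[ y ] 0# < y × y + y ≈ x
  half 0<x = let y , 0<y , 2y≈x = fraction 1 0<x in
    y , 0<y , trans (solve 1 (λ a → a :+ a := (con 1 :+ (con 1 :+ con 0)) :* a) refl y) 2y≈x

  below-both : ∀ {x y} → 0# < x → 0# < y → ∃[ z ] 0# < z × z ≤ x × z ≤ y
  below-both {x} {y} 0<x 0<y with total x y
  ... | inj₁ x≤y = x , 0<x , ≤-refl , x≤y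
  ... | inj₂ y≤x = y , 0<y , y≤x , ≤-refl

  -- If x > y, taking `η` to be half the gap leaves y + η strictly below x.
  ≤-fromAbove : ∀ {x y} → (∀ η → 0# < η → x ≤ y + η) → x ≤ y
  ≤-fromAbove {x} {y} h with total x y
  ... | inj₁ x≤y = x≤y
  ... | inj₂ y≤x with em {P = x ≈ y}
  ...   | yes x≈y = ≤-reflexive x≈y
  ...   | no  x≉y with half (x<y⇒0<y-x (y≤x , λ y≈x → x≉y (sym y≈x)))
  ...     | η , 0<η , 2η≈x-y = ⊥-elim (<⇒≱ (begin-strict
      y + η        <⟨ x<x+y (y + η) 0<η ⟩
      y + η + η    ≈⟨ +-assoc y η η ⟩
      y + (η + η)  ≈⟨ +-congˡ 2η≈x-y ⟩
      y + (x - y)  ≈⟨ +-comm y (x - y) ⟩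
      x - y + y    ≈⟨ x-y+y≈x x y ⟩
      x            ∎) (h η 0<η))

  -x≤∣x∣ : ∀ x → - x ≤ ∣ x ∣
  -x≤∣x∣ x with total (- x) x
  ... | inj₁ -x≤x = -x≤x
  ... | inj₂ _    = ≤-refl

  ∣∣-nonNeg : ∀ {x} → 0# ≤ x → ∣ x ∣ ≈ x
  ∣∣-nonNeg {x} 0≤x with total (- x) x
  ... | inj₁ _    = refl
  ... | inj₂ x≤-x = antisym (≤-trans (≤-respʳ-≈ -0≈0 (neg-antimono 0≤x)) 0≤x) x≤-x

  ∣x-y∣≤⇒y≤x+ : ∀ {x y η} → ∣ x - y ∣ ≤ η → y ≤ x + η
  ∣x-y∣≤⇒y≤x+ {x} {y} {η} p = begin
    y                ≈⟨ x-y+y≈x y x ⟨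
    y - x + x        ≈⟨ +-comm _ _ ⟩
    x + (y - x)      ≈⟨ +-congˡ lemma ⟩
    x + - (x - y)    ≤⟨ +-monoʳ-≤ x (≤-trans (-x≤∣x∣ (x - y)) p) ⟩
    x + η            ∎
    where
    open AbelianGroupProperties +-abelianGroup using (⁻¹-∙-comm)
    lemma : y - x ≈ - (x - y)
    lemma = begin-equality
      y - x          ≈⟨ +-comm y (- x) ⟩
      - x + y        ≈⟨ +-congˡ (⁻¹-involutive y) ⟨
      - x + - - y    ≈⟨ ⁻¹-∙-comm x (- y) ⟩
      - (x - y)      ∎

  small-rational : ∀ {δ} → 0# < δ → ∃[ ε ] 0# < fromℚ ε × ε ≢ 0ℚ × ∣ fromℚ ε ∣ < δ
  small-rational {δ} 0<δ with archimedean 0<δ 1#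
  ... | n , 1≤nδ = ε , 0<ε , (λ ()) , ≤-<-trans (≤-reflexive (∣∣-nonNeg (proj₁ 0<ε))) (begin-strict
      fromℚ ε                        ≈⟨ *-congʳ (+-identityʳ 1#) ⟩
      1# * N ⁻¹                      <⟨ proj₁ lt , proj₂ lt ⟩
      (N * δ) * N ⁻¹
        ≈⟨ solve 3 (λ a b c → (a :* b) :* c := (b :* a) :* c) refl N δ (N ⁻¹) ⟩
      (δ * N) * N ⁻¹                 ≈⟨ x*y*y⁻¹≈x δ (fromℕ-suc≉0 n) ⟩
      δ                              ∎)
    where
    -- `mkℚ` takes the denominator minus one, so this is 1/(n+1). Passing from n to n+1 turns 1 ≤ nδ
    -- into the strict inequality `1<Nδ`.
    ε = mkℚ (+ 1) n (Coprimality.1-coprimeTo (suc n))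
    N = fromℕ (suc n)
    0<N⁻¹ : 0# < N ⁻¹
    0<N⁻¹ = 0<⁻¹ (0<fromℕ-suc n)
    0<ε : 0# < fromℚ ε
    0<ε = 0<* (0<fromℕ-suc 0) 0<N⁻¹
    1<Nδ : 1# < N * δ
    1<Nδ = ≤-<-trans 1≤nδ (<-respʳ-≈ (sym (fromℕ-suc-* n δ)) (x<x+y _ 0<δ))
    lt : 1# * N ⁻¹ < (N * δ) * N ⁻¹
    lt = *-monoʳ-≤ (proj₁ 0<N⁻¹) (proj₁ 1<Nδ) , λ eq → proj₂ 1<Nδ
      (antisym (proj₁ 1<Nδ) (*-cancelʳ-≤ 0<N⁻¹ (≤-reflexive (sym eq))))

  inf-lower : ∀ {I : Set} (f : I → Carrier) i b j → inf f i b ≤ f j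
  inf-lower f i b j = begin
    inf f i b  ≤⟨ neg-antimono (IsLUB.upper (proj₂ (complete _ i _)) j) ⟩
    - - f j    ≈⟨ ⁻¹-involutive _ ⟩
    f j        ∎

  inf-greatest : ∀ {I : Set} (f : I → Carrier) i b {x} → (∀ j → x ≤ f j) → x ≤ inf f i b
  inf-greatest f i b {x} h = begin
    x          ≈⟨ ⁻¹-involutive x ⟨
    - - x
      ≤⟨ neg-antimono (IsLUB.least (proj₂ (complete _ i _)) (- x) λ j → neg-antimono (h j)) ⟩
    inf f i b  ∎

-- Finite additivity of a Borel measure of finite total mass.

module FiniteMeasure
  (em : ∀ {ℓ} → ExcludedMiddle ℓ) {ℝ : CompleteOrderedField} {X : MetricSpace ℝ}
  (M : BorelMeasure X) (μX<∞ : CompleteOrderedField._<⁺_ ℝ (μX M) ⊤⁺)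
  where
  open CompleteOrderedField ℝ hiding (zero)
  open RealProperties em ℝ
  open NaturalCoefficients commutativeSemiring using (solve; _:+_; _:*_; _:=_; con)
  open BorelMeasure M
  private module X = MetricSpace X

  private variable A B C R : Pred X.Carrier 0ℓ

  ∅-borel : Borel X ∅
  ∅-borel = open-set λ _ ()

  -- Pads a pair with empty sets to a sequence, because `Borel` and `BorelMeasure` speak only of
  -- countable unions.
  then∅ : Pred X.Carrier 0ℓ → Pred X.Carrier 0ℓ → ℕ → Pred X.Carrier 0ℓ
  then∅ A B 0             = A
  then∅ A B 1             = B
  then∅ A B (suc (suc _)) = ∅

  then∅-borel : Borel X A → Borel X B → ∀ n → Borel X (then∅ A B n)
  then∅-borel a b 0             = a
  then∅-borel a b 1             = b
  then∅-borel a b (suc (suc _)) = ∅-borel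

  then∅-disjoint : Empty (A ∩ B) → ∀ m n → m ≢ n → Empty (then∅ A B m ∩ then∅ A B n)
  then∅-disjoint A∩B=∅ 0             0             m≢n = ⊥-elim (m≢n ≡.refl)
  then∅-disjoint A∩B=∅ 0             1             m≢n x x∈            = A∩B=∅ x x∈
  then∅-disjoint A∩B=∅ 1             0             m≢n x (x∈B , x∈A)   = A∩B=∅ x (x∈A , x∈B)
  then∅-disjoint A∩B=∅ 1             1             m≢n = ⊥-elim (m≢n ≡.refl)
  then∅-disjoint A∩B=∅ (suc (suc _)) _             m≢n x (() , _)
  then∅-disjoint A∩B=∅ 0             (suc (suc _)) m≢n x (_ , ())
  then∅-disjoint A∩B=∅ 1             (suc (suc _)) m≢n x (_ , ())

  ⋃-then∅ : ⋃ ℕ (then∅ A B) ≐ A ∪ B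
  ⋃-then∅ = (λ { (0 , x∈A) → inj₁ x∈A ; (1 , x∈B) → inj₂ x∈B ; (suc (suc _) , ()) })
          , (λ { (inj₁ x∈A) → 0 , x∈A ; (inj₂ x∈B) → 1 , x∈B })

  abstract
    -- De Morgan: the intersection is the complement of a union of complements. Excluded middle
    -- removes the double negations.
    ∩-borel : Borel X A → Borel X B → Borel X (A ∩ B)
    ∩-borel {A} {B} a b =
      resp-≐ ((λ x∉ → decidable-stable em (λ x∉A → x∉ (0 , x∉A)) ,
                      decidable-stable em (λ x∉B → x∉ (1 , x∉B)))
             , λ { (x∈A , _) (0 , x∉A) → x∉A x∈A
                 ; (_ , x∈B) (1 , x∉B) → x∉B x∈B
                 ; _ (suc (suc _) , ()) })
        (complement (union (then∅-borel (complement a) (complement b))))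

  ⊤≰finite : ∀ {s t} → t <⁺ ⊤⁺ → s ≈⁺ t → ¬ (⊤⁺ ≤⁺ s)
  ⊤≰finite SupStrict.[ _ ]<⊤⁺ SupEquality.[ _ ] ()

  split-U : ∀ {A} → ⋃ ℕ (then∅ A (∁ A)) ≐ U
  split-U {A} = _ , λ {x} _ → [ (λ x∈A → 0 , x∈A) , (λ x∉A → 1 , x∉A) ]′ (toSum (em {P = A x}))

  abstract
    -- Were μ(A) infinite, the first partial sum for the sequence A, ∁ A, ∅, ... would be infinite
    -- too, yet it is bounded by the measure of the union, which is the whole space.
    μ-finite : (a : Borel X A) → ∃[ x ] μ A a ≡ [ x ]
    μ-finite {A} a with μ A a in eq
    ... | [ x ] = x , ≡.refl
    ... | ⊤⁺    = ⊥-elim (⊤≰finite μX<∞ (μ-cong (union borel) _ split-U)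
      (≡.subst (λ s → ([ 0# ] +⁺ s) ≤⁺ μ _ (union borel)) eq
        (IsLUB.upper (μ-union borel (then∅-disjoint λ _ (p , q) → q p)) 1)))
      where
      borel : ∀ n → Borel X (then∅ A (∁ A) n)
      borel = then∅-borel a (complement a)

  m : Borel X A → Carrier
  m a = proj₁ (μ-finite a)

  μ≡m : (a : Borel X A) → μ A a ≡ [ m a ]
  μ≡m a = proj₂ (μ-finite a)

  -- A value of `μ` does not reduce to the form `[ x ]` and is only provably equal to one by `μ≡m`.
  -- Taking such equalities as arguments allows matching on them.
  [≈]-injective : ∀ {s t x y} → s ≡ [ x ] → t ≡ [ y ] → s ≈⁺ t → x ≈ y
  [≈]-injective ≡.refl ≡.refl SupEquality.[ p ] = p

  [≤]-injective : ∀ {s t x y} → s ≡ [ x ] → t ≡ [ y ] → s ≤⁺ t → x ≤ y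
  [≤]-injective ≡.refl ≡.refl SupNonStrict.[ p ] = p

  [<]-injective : ∀ {s x y} → s ≡ [ y ] → [ x ] <⁺ s → x < y
  [<]-injective ≡.refl SupStrict.[ p ] = p

  m-cong : (a : Borel X A) (b : Borel X B) → A ≐ B → m a ≈ m b
  m-cong a b A≐B = [≈]-injective (μ≡m a) (μ≡m b) (μ-cong a b A≐B)

  m-nonNeg : (a : Borel X A) → 0# ≤ m a
  m-nonNeg a = [≤]-injective ≡.refl (μ≡m a) (μ-nonNeg a)

  m-empty : (a : Borel X A) → Empty A → m a ≈ 0#
  m-empty a A=∅ = [≈]-injective (μ≡m a) ≡.refl (μ-empty a A=∅)

  finiteValue≡m : (a : Borel X A) (a<∞ : μ A a <⁺ ⊤⁺) → finiteValue (μ A a) a<∞ ≡ m a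
  finiteValue≡m {A} a a<∞ = lemma (μ≡m a) a<∞
    where
    lemma : ∀ {s x} → s ≡ [ x ] → (p : s <⁺ ⊤⁺) → finiteValue s p ≡ x
    lemma ≡.refl _ = ≡.refl

  -- Countable additivity for A, B, ∅, ∅, ...: from index 2 on the partial sums equal `m a + m b`,
  -- which is therefore their least upper bound. Allowing any `R` with the same points as the union
  -- makes the result independent of how `R` was derived to be Borel.
  m-∪ : (a : Borel X A) (b : Borel X B) (r : Borel X R) →
        R ≐ A ∪ B → Empty (A ∩ B) → m r ≈ m a + m b
  m-∪ {A} {B} {R} a b r R≐A∪B A∩B=∅ = trans (m-cong r (union borel) R≐⋃) (antisym
    ([≤]-injective (μ≡m (union borel)) ≡.refl (IsLUB.least lub [ m a + m b ] sums≤))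
    (≤-respˡ-≈ (sum≈ 0) ([≤]-injective (partialSum≡ 2) (μ≡m (union borel)) (IsLUB.upper lub 2))))
    where
    borel : ∀ n → Borel X (then∅ A B n)
    borel = then∅-borel a b
    lub = μ-union borel (then∅-disjoint A∩B=∅)
    sum : ℕ → Carrier
    sum 0       = 0#
    sum (suc n) = sum n + m (borel n)
    R≐⋃ : R ≐ ⋃ ℕ (then∅ A B)
    R≐⋃ = (λ x∈R → proj₂ ⋃-then∅ (proj₁ R≐A∪B x∈R)) , (λ x∈⋃ → proj₂ R≐A∪B (proj₁ ⋃-then∅ x∈⋃))
    partialSum≡ : ∀ n → partialSum (λ n → μ (then∅ A B n) (borel n)) n ≡ [ sum n ]
    partialSum≡ zero    = ≡.refl
    partialSum≡ (suc n) = ≡.cong₂ _+⁺_ (partialSum≡ n) (μ≡m (borel n))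
    sum≈ : ∀ n → sum (2 ℕ.+ n) ≈ m a + m b
    sum≈ zero    = +-congʳ (+-identityˡ (m a))
    sum≈ (suc n) = trans (+-cong (sum≈ n) (m-empty ∅-borel λ _ ())) (+-identityʳ _)
    sums≤ : ∀ n → partialSum (λ n → μ (then∅ A B n) (borel n)) n ≤⁺ [ m a + m b ]
    sums≤ n = ≡.subst (_≤⁺ _) (≡.sym (partialSum≡ n)) SupNonStrict.[ lemma n ]
      where
      lemma : ∀ n → sum n ≤ m a + m b
      lemma 0             = ≤-trans (m-nonNeg a) (x≤x+y _ (m-nonNeg b))
      lemma 1             = ≤-respˡ-≈ (sym (+-identityˡ _)) (x≤x+y _ (m-nonNeg b))
      lemma (suc (suc n)) = ≤-reflexive (sum≈ n)

  m-split : (r : Borel X R) (c : Borel X C) →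
            m r ≈ m (∩-borel r c) + m (∩-borel r (complement c))
  m-split {R} {C} r c = m-∪ (∩-borel r c) (∩-borel r (complement c)) r
    ( (λ {x} x∈R → [ (λ x∈C → inj₁ (x∈R , x∈C)) , (λ x∉C → inj₂ (x∈R , x∉C)) ]′ (toSum (em {P = C x})))
    , [ proj₁ , proj₁ ]′ )
    λ _ ((_ , x∈C) , (_ , x∉C)) → x∉C x∈C

  m-mono : (a : Borel X A) (b : Borel X B) → A ⊆ B → m a ≤ m b
  m-mono a b A⊆B = begin
    m a
      ≈⟨ m-cong a (∩-borel b a) ((λ x∈A → A⊆B x∈A , x∈A) , proj₂) ⟩
    m (∩-borel b a)                                    ≤⟨ x≤x+y _ (m-nonNeg _) ⟩
    m (∩-borel b a) + m (∩-borel b (complement a))     ≈⟨ m-split b a ⟨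
    m b                                                ∎

  ball : ∀ r x → Borel X (Ball X r x)
  ball r x = open-set (ball-open {X = X} r x)

  univ : Borel X U
  univ = open-set (U-open {X = X})

  -- Double counting of points against balls.

  covers? : ∀ r y u → Dec (Ball X r u y)
  covers? r y u = em

  centresNear : Carrier → X.Carrier → List X.Carrier → List X.Carrier
  centresNear r y = filter (covers? r y)

  coverage : Borel X B → Carrier → List X.Carrier → Carrier
  coverage b r []       = 0#
  coverage b r (u ∷ us) = m (∩-borel b (ball r u)) + coverage b r us

  m-split-∩ : (b : Borel X B) (c : Borel X C) (a : Borel X A) →
              m (∩-borel b a) ≈ m (∩-borel (∩-borel b c) a) + m (∩-borel (∩-borel b (complement c)) a)
  m-split-∩ {B} {C} b c a = m-∪ (∩-borel (∩-borel b c) a) (∩-borel (∩-borel b (complement c)) a) _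
    ( (λ {x} (x∈B , x∈A) → [ (λ x∈C → inj₁ ((x∈B , x∈C) , x∈A))
                           , (λ x∉C → inj₂ ((x∈B , x∉C) , x∈A)) ]′ (toSum (em {P = C x})))
    , [ (λ ((x∈B , _) , x∈A) → x∈B , x∈A) , (λ ((x∈B , _) , x∈A) → x∈B , x∈A) ]′ )
    λ _ (((_ , x∈C) , _) , ((_ , x∉C) , _)) → x∉C x∈C

  coverage-split : (b : Borel X B) (c : Borel X C) → ∀ r us →
                   coverage b r us ≈ coverage (∩-borel b c) r us + coverage (∩-borel b (complement c)) r us
  coverage-split b c r []       = sym (+-identityˡ 0#)
  coverage-split b c r (u ∷ us) = trans (+-cong (m-split-∩ b c (ball r u)) (coverage-split b c r us))
    (solve 4 (λ p q s t → (p :+ q) :+ (s :+ t) := (p :+ s) :+ (q :+ t)) refl _ _ _ _)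

  -- The double counting ∑ᵤ m(B ∩ ball u) = ∫_B #{u : y ∈ ball u} dy ≤ κ m(B),
  -- done without integrals by cutting B along each ball in turn.
  coverage≤ : (b : Borel X B) → ∀ r us κ → (∀ y → B y → fromℕ (length (centresNear r y us)) ≤ κ) →
             coverage b r us ≤ κ * m b
  -- The recursion lowers `κ` by one inside each ball, so on an empty piece `κ` may be negative. A
  -- point of `B` shows that it is nonnegative; without one the measure is zero.
  coverage≤ {B} b r [] κ count≤κ with em {P = ∃[ y ] B y}
  ... | yes (y , y∈B) = *-nonNeg (count≤κ y y∈B) (m-nonNeg b)
  ... | no  B=∅       = ≤-reflexive (sym (trans (*-congˡ (m-empty b λ y y∈B → B=∅ (y , y∈B))) (zeroʳ κ)))
  coverage≤ {B} b r (u ∷ us) κ count≤κ = begin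
    m b₁ + coverage b r us                     ≈⟨ +-congˡ (coverage-split b (ball r u) r us) ⟩
    m b₁ + (coverage b₁ r us + coverage b₂ r us)
      ≤⟨ +-monoʳ-≤ (m b₁) (+-mono-≤ (coverage≤ b₁ r us (κ - 1#) inside)
                                 (coverage≤ b₂ r us κ outside)) ⟩
    m b₁ + ((κ - 1#) * m b₁ + κ * m b₂)
      ≈⟨ solve 4 (λ x k l y → x :+ (l :* x :+ k :* y) := (l :+ con 1) :* x :+ k :* y) refl (m b₁) κ (κ - 1#) (m b₂) ⟩
    ((κ - 1#) + 1#) * m b₁ + κ * m b₂  ≈⟨ +-congʳ (*-congʳ (x-y+y≈x κ 1#)) ⟩
    κ * m b₁ + κ * m b₂                       ≈⟨ distribˡ κ (m b₁) (m b₂) ⟨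
    κ * (m b₁ + m b₂)                         ≈⟨ *-congˡ (m-split b (ball r u)) ⟨
    κ * m b                                   ∎
    where
    b₁ = ∩-borel b (ball r u)
    b₂ = ∩-borel b (complement (ball r u))
    inside : ∀ y → (B ∩ Ball X r u) y → fromℕ (length (centresNear r y us)) ≤ κ - 1#
    inside y (y∈B , y∈ball) = x+y≤z⇒x≤z-y (≤-respˡ-≈ (trans
      (reflexive (≡.cong (fromℕ ∘ length) (filter-accept (covers? r y) {xs = us} y∈ball)))
      (+-comm 1# _)) (count≤κ y y∈B))
    outside : ∀ y → (B ∩ ∁ (Ball X r u)) y → fromℕ (length (centresNear r y us)) ≤ κ
    outside y (y∈B , y∉ball) = ≤-respˡ-≈
      (reflexive (≡.cong (fromℕ ∘ length) (filter-reject (covers? r y) {xs = us} y∉ball))) (count≤κ y y∈B)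

  coverage-univ : ∀ {r v} → (∀ u → m (ball r u) ≈ v) → ∀ us → coverage univ r us ≈ fromℕ (length us) * v
  coverage-univ {r} {v} m≈v []       = sym (zeroˡ v)
  coverage-univ {r} {v} m≈v (u ∷ us) = begin-equality
    m (∩-borel univ (ball r u)) + coverage univ r us
      ≈⟨ +-cong (trans (m-cong _ _ (proj₂ , (_ ,_))) (m≈v u)) (coverage-univ m≈v us) ⟩
    v + fromℕ (length us) * v                        ≈⟨ +-comm _ _ ⟩
    fromℕ (length us) * v + v                        ≈⟨ fromℕ-suc-* (length us) v ⟨
    fromℕ (suc (length us)) * v                      ∎

  -- Serves both bounds: `κ` is 1 for packing, and the largest density times the size of W for the
  -- lower bound.
  double-count : ∀ {r v} → (∀ u → m (ball r u) ≈ v) → ∀ us κ →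
                 (∀ y → fromℕ (length (centresNear r y us)) ≤ κ) → fromℕ (length us) * v ≤ κ * m univ
  double-count m≈v us κ count≤κ =
    ≤-respˡ-≈ (coverage-univ m≈v us) (coverage≤ univ _ us κ λ y _ → count≤κ y)

  -- Packing and total boundedness.

  open IsGeneralMetric X.isMetric using () renaming (sym to d-sym)

  Separated : Carrier → List X.Carrier → Set
  Separated r = AllPairs (λ u v → r + r ≤ X.d u v)

  -- A point within `r` of two centres would put them less than `r + r` apart, so the first centre
  -- that covers `y` excludes all later ones.
  separated⇒disjoint : ∀ {r us} → Separated r us → ∀ y → length (centresNear r y us) ℕ.≤ 1
  separated⇒disjoint []                          y = ℕ.z≤n
  separated⇒disjoint {r} {u ∷ us} (far ∷ separated) y with covers? r y u
  ... | no  _    = separated⇒disjoint separated y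
  ... | yes y∈ball = ≡.subst (λ vs → suc (length vs) ℕ.≤ 1)
    (≡.sym (filter-none (covers? r y) (All.map disjoint far))) ℕ.≤-refl
    where
    disjoint : ∀ {v} → r + r ≤ X.d u v → ¬ Ball X r v y
    disjoint {v} 2r≤duv dvy<r = <⇒≱ (begin-strict
      X.d u v            ≤⟨ X.triangle u y v ⟩
      X.d u y + X.d y v  <⟨ +-mono-<-≤ y∈ball (≤-respˡ-≈ (d-sym v y) (proj₁ dvy<r)) ⟩
      r + r              ∎) 2r≤duv

  packing : ∀ {r v us} → (∀ u → m (ball r u) ≈ v) → Separated r us → fromℕ (length us) * v ≤ m univ
  packing {us = us} m≈v separated = ≤-respʳ-≈ (trans (*-congʳ (+-identityʳ 1#)) (*-identityˡ _))
    (double-count m≈v us _ λ y → fromℕ-mono (separated⇒disjoint separated y))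

  -- Greedy choice: as long as the current centres leave a point uncovered, that point extends the
  -- separated list. Packing bounds the length of such a list, so the process ends with a cover.
  totallyBounded : ∀ {r v} → (∀ u → m (ball r u) ≈ v) → 0# < v →
                   ∃[ xs ] ∀ y → Any (λ x → X.d x y < r + r) xs
  -- The additional `v` makes the contradiction with `packing` strict.
  totallyBounded {r} {v} m≈v 0<v with archimedean 0<v (m univ + v)
  ... | n , T+v≤nv = [ id , (λ (us , separated , ∣us∣≡n) → ⊥-elim (<⇒≱ (x<x+y _ 0<v) (begin
      m univ + v             ≤⟨ T+v≤nv ⟩
      fromℕ n * v            ≡⟨ ≡.cong (λ k → fromℕ k * v) ∣us∣≡n ⟨
      fromℕ (length us) * v  ≤⟨ packing m≈v separated ⟩
      m univ                 ∎))) ]′ (coverOrSeparated n)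
    where
    coverOrSeparated : ∀ n → (∃[ xs ] ∀ y → Any (λ x → X.d x y < r + r) xs) ⊎
                             (∃[ us ] Separated r us × length us ≡ n)
    coverOrSeparated zero    = inj₂ ([] , [] , ≡.refl)
    coverOrSeparated (suc n) with coverOrSeparated n
    ... | inj₁ cover = inj₁ cover
    ... | inj₂ (us , separated , ∣us∣≡n) with em {P = ∃[ y ] ¬ Any (λ x → X.d x y < r + r) us}
    ...   | yes (y , far) = inj₂
      ( y ∷ us
      , All.map (λ dxy≮2r → ≤-respʳ-≈ (d-sym _ y) (≮⇒≥ dxy≮2r)) (¬Any⇒All¬ us far) ∷ separated
      , ≡.cong suc ∣us∣≡n )
    ...   | no  covered   = inj₁ (us , λ y → decidable-stable em λ far → covered (y , far))

-- `Q` is demanded only of the elements that `P?` keeps, since adjacency to a common neighbour is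
-- known only for the listed vertices.
length-filter-mono : ∀ {A : Set} {P Q : Pred A 0ℓ} (P? : Decidable P) (Q? : Decidable Q) xs →
                     All Q (filter P? xs) → length (filter P? xs) ℕ.≤ length (filter Q? xs)
length-filter-mono P? Q? []       qs = ℕ.z≤n
length-filter-mono P? Q? (x ∷ xs) qs with P? x | Q? x | qs
... | yes _ | yes _  | _ ∷ qs′ = ℕ.s≤s (length-filter-mono P? Q? xs qs′)
... | yes _ | no ¬q  | q ∷ _   = ⊥-elim (¬q q)
... | no _  | yes _  | qs′     = ℕ.m≤n⇒m≤1+n (length-filter-mono P? Q? xs qs′)
... | no _  | no _   | qs′     = length-filter-mono P? Q? xs qs′

-- Vertex degrees and uniform ball measures.

module GECDensity
  (em : ∀ {ℓ} → ExcludedMiddle ℓ) {ℝ : CompleteOrderedField} {X : MetricSpace ℝ}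
  {M : BorelMeasure X} (ud : IsUniformlyDistributed M)
  (μX<∞ : CompleteOrderedField._<⁺_ ℝ (μX M) ⊤⁺)
  {G : Graph X} (dense : Dense X (Graph.V G)) (gec : IsGEC X G)
  where
  open CompleteOrderedField ℝ hiding (zero)
  open RealProperties em ℝ
  open FiniteMeasure em M μX<∞
  open NaturalCoefficients commutativeSemiring using (solve; _:+_; _:*_; _:=_)
  open IsUniformlyDistributed ud
  open Graph G
  open IsGEC gec
  open FiniteSubset
  private
    module X = MetricSpace X
    open module D = IsGeneralMetric X.isMetric using () renaming (sym to d-sym; cong to d-cong)

  T : Carrier
  T = m univ

  size : FiniteSubset X V → Carrier
  size W = fromℕ (length (elements W))

  degree : FiniteSubset X V → X.Carrier → Carrier
  degree W v = fromℕ (degreeInto em G W v)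

  adjacent? : ∀ v → Decidable (v ~_)
  adjacent? v w = em {P = v ~ w}

  degree-++ : ∀ {W W′ us} v → elements W′ ≡ us ++ elements W →
              degree W′ v ≈ fromℕ (length (filter (adjacent? v) us)) + degree W v
  degree-++ {W} {W′} {us} v W′≡ = begin-equality
    degree W′ v
      ≡⟨ ≡.cong (λ ws → fromℕ (length (filter (adjacent? v) ws))) W′≡ ⟩
    fromℕ (length (filter (adjacent? v) (us ++ elements W)))
      ≡⟨ ≡.cong (λ ws → fromℕ (length ws)) (filter-++ (adjacent? v) us (elements W)) ⟩
    fromℕ (length (filter (adjacent? v) us ++ filter (adjacent? v) (elements W)))
      ≡⟨ ≡.cong fromℕ (length-++ (filter (adjacent? v) us)) ⟩
    fromℕ (length (filter (adjacent? v) us) ℕ.+ length (filter (adjacent? v) (elements W)))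
      ≈⟨ fromℕ-+ (length (filter (adjacent? v) us)) _ ⟩
    fromℕ (length (filter (adjacent? v) us)) + degree W v       ∎

  ballVolume≡m : ∀ {r} (0<r : 0# < r) x → ballVolume ud r 0<r x ≡ m (ball r x)
  ballVolume≡m {r} 0<r x = finiteValue≡m (ball r x) (ball-finite r 0<r x)

  m-ball-equal : ∀ {r} → 0# < r → ∀ x y → m (ball r x) ≈ m (ball r y)
  m-ball-equal {r} 0<r x y = [≈]-injective (μ≡m (ball r x)) (μ≡m (ball r y)) (ball-equal r 0<r x y)

  m-ball-positive : ∀ {r} → 0# < r → ∀ x → 0# < m (ball r x)
  m-ball-positive {r} 0<r x = [<]-injective (μ≡m (ball r x)) (ball-positive r 0<r x)

  0<T : X.Carrier → 0# < T
  0<T x = <-≤-trans (m-ball-positive 0<1 x) (m-mono (ball 1# x) univ _)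

  -- Vertices supplied by the extension property.

  restrict : {P : Pred X.Carrier 0ℓ} → Decidable P → FiniteSubset X V → FiniteSubset X V
  restrict P? W = record
    { elements = filter P? (elements W)
    ; unique   = AllPairsProperties.filter⁺ P? (unique W)
    ; inside   = AllProperties.filter⁺ P? (inside W)
    }

  none : FiniteSubset X V
  none = record { elements = [] ; unique = [] ; inside = [] }

  Ball-resp : ∀ {r x y z} → y X.≈ z → Ball X r x y → Ball X r x z
  Ball-resp {x = x} y≈z = <-respˡ-≈ (d-cong (D.EqC.refl {x}) y≈z)

  near? : ∀ s → Decidable (Ball X 1# s)
  near? s w = em

  -- Density gives a vertex `s` near `x`. Extension at `s`, with no vertex to be joined and the part
  -- of `W` in B₁(s) to be avoided, gives a vertex still closer to `s`.
  fresh-vertex : ∀ x {δ} → 0# < δ → (W : FiniteSubset X V) →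
                 ∃[ v ] V v × Ball X δ x v × ¬ (_∈ₗ_ X v (elements W))
  fresh-vertex x {δ} 0<δ W with dense x δ 0<δ
  -- ε ≤ 1 keeps the new vertex in B₁(s), so that avoiding `W` there is avoiding all of `W`. ε ≤ δ -
  -- d(x,s) keeps it within `δ` of `x`.
  ... | s , s∈V , dxs<δ with below-both 0<1 (x<y⇒0<y-x dxs<δ)
  ...   | ε , 0<ε , ε≤1 , ε≤δ-dxs
        with extension s s∈V none (restrict (near? s) W) (λ ()) []
               (AllProperties.all-filter (near? s) (elements W)) ε 0<ε
  ...     | v , v∈V , _ , v∉B , dsv<ε , _ , _ = v , v∈V , close , λ v∈W →
            v∉B (∈-filter⁺ X.setoid (near? s) Ball-resp v∈W (<-≤-trans dsv<ε ε≤1))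
    where
    close : X.d x v < δ
    close = begin-strict
      X.d x v            ≤⟨ X.triangle x s v ⟩
      X.d x s + X.d s v  ≈⟨ +-comm _ _ ⟩
      X.d s v + X.d x s  <⟨ +-mono-<-≤ dsv<ε ≤-refl ⟩
      ε + X.d x s        ≤⟨ x≤z-y⇒x+y≤z ε≤δ-dxs ⟩
      δ                  ∎

  add-vertices : ∀ x {δ} → 0# < δ → ∀ n (W : FiniteSubset X V) →
                 ∃[ W′ ] ∃[ us ] elements W′ ≡ us ++ elements W × length us ≡ n × All (Ball X δ x) us
  add-vertices x 0<δ zero    W = W , [] , ≡.refl , ≡.refl , []
  add-vertices x 0<δ (suc n) W with add-vertices x 0<δ n W
  ... | W′ , us , W′≡ , ∣us∣≡n , us-close with fresh-vertex x 0<δ W′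
  ...   | v , v∈V , v-close , v∉W′ =
    record
      { elements = v ∷ elements W′
      ; unique   = ¬Any⇒All¬ _ v∉W′ ∷ unique W′
      ; inside   = v∈V ∷ inside W′
      } ,
    v ∷ us , ≡.cong (v ∷_) W′≡ , ≡.cong suc ∣us∣≡n , v-close ∷ us-close

  -- Finitely many strict inequalities share a positive slack `ρ`; every point within `ρ` of `x`
  -- still has all of `us` in its open unit ball.
  room : ∀ x us → All (Ball X 1# x) us → ∃[ ρ ] 0# < ρ × All (λ u → ρ + X.d x u ≤ 1#) us
  room x []       []           = 1# , 0<1 , []
  room x (u ∷ us) (dxu<1 ∷ ps) with room x us ps
  ... | ρ , 0<ρ , fits with below-both 0<ρ (x<y⇒0<y-x dxu<1)
  ...   | ρ′ , 0<ρ′ , ρ′≤ρ , ρ′≤1-dxu =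
    ρ′ , 0<ρ′ , x≤z-y⇒x+y≤z ρ′≤1-dxu ∷ All.map (≤-trans (+-monoˡ-≤ _ ρ′≤ρ)) fits

  -- The extension property holds at vertices while `x` is any point. By `room`, `x` can be moved to
  -- a nearby vertex `s` without losing `A` from the unit ball.
  common-neighbour : ∀ x (A : FiniteSubset X V) → All (Ball X 1# x) (elements A) →
                     ∃[ v ] V v × All (v ~_) (elements A)
  common-neighbour x A A⊆ball with room x (elements A) A⊆ball
  ... | ρ , 0<ρ , fits with dense x ρ 0<ρ
  ...   | s , s∈V , dxs<ρ with extension s s∈V A none (λ ()) (All.map close fits) [] 1# 0<1
    where
    close : ∀ {u} → ρ + X.d x u ≤ 1# → X.d s u < 1#
    close {u} ρ+dxu≤1 = begin-strict
      X.d s u            ≤⟨ X.triangle s x u ⟩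
      X.d s x + X.d x u  ≈⟨ +-congʳ (d-sym s x) ⟩
      X.d x s + X.d x u  <⟨ +-mono-<-≤ dxs<ρ ≤-refl ⟩
      ρ + X.d x u        ≤⟨ ρ+dxu≤1 ⟩
      1#                 ∎
  ...     | v , v∈V , _ , _ , _ , v~A , _ = v , v∈V , v~A

  -- The lower bound, and a criterion for the upper bound.

  module _ (o : Satisfiable V) where

    x₀ : X.Carrier
    x₀ = proj₁ o

    b : Carrier
    b = m (ball 1# x₀)

    -- The vertices of W within 1 of a point y have a common neighbour, so at most s N of the unit
    -- balls around W contain y. Double counting gives N b ≤ s N T.
    b≤supDensity*T : ∀ W → b ≤ supDensity em G o W * T
    b≤supDensity*T W⁺@(W , _) = *-cancelʳ-≤ 0<N (begin
      b * N        ≈⟨ *-comm b N ⟩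
      N * b        ≤⟨ double-count (λ u → m-ball-equal 0<1 u x₀) (elements W) (s * N) count≤ ⟩
      s * N * T    ≈⟨ solve 3 (λ x y z → x :* y :* z := x :* z :* y) refl s N T ⟩
      s * T * N    ∎)
      where
      N s : Carrier
      N = size W
      s = supDensity em G o W⁺
      0<N : 0# < N
      0<N = fromℕ-nonNeg (length (elements W)) , λ 0≈N → size≉0 em G W⁺ (sym 0≈N)
      count≤ : ∀ y → fromℕ (length (centresNear 1# y (elements W))) ≤ s * N
      count≤ y with common-neighbour y (restrict (covers? 1# y) W)
                      (All.map (λ {u} → <-respˡ-≈ (d-sym u y))
                        (AllProperties.all-filter (covers? 1# y) (elements W)))
      ... | v , v∈V , v~ = begin
        fromℕ (length (centresNear 1# y (elements W)))
          ≤⟨ fromℕ-mono (length-filter-mono (covers? 1# y) (adjacent? v) (elements W) v~) ⟩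
        degree W v                                      ≈⟨ x*y⁻¹*y≈x _ (>⇒≉0 0<N) ⟨
        density em G W v * N
          ≤⟨ *-monoʳ-≤ (proj₁ 0<N) (IsLUB.upper (proj₂ (complete _ o _)) (v , v∈V)) ⟩
        s * N                                           ∎

    b≤α*T : b ≤ α em G o * T
    b≤α*T = begin
      b               ≈⟨ x*y⁻¹*y≈x b T≉0 ⟨
      b * T ⁻¹ * T    ≤⟨ *-monoʳ-≤ (m-nonNeg univ) (inf-greatest _ _ _ λ W → *-cancelʳ-≤ (0<T x₀)
                          (≤-respˡ-≈ (sym (x*y⁻¹*y≈x b T≉0)) (b≤supDensity*T W))) ⟩
      α em G o * T    ∎
      where T≉0 = >⇒≉0 (0<T x₀)

    α*T≤supDensity*T : ∀ W → α em G o * T ≤ supDensity em G o W * T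
    α*T≤supDensity*T W = *-monoʳ-≤ (m-nonNeg univ) (inf-lower (supDensity em G o) _ _ W)

    -- Giving each vertex the weight `c` turns counts into measures: a density times T is at most
    -- the density times N c, which is the degree times `c`. As T > 0, W is nonempty.
    supDensity*T≤ : ∀ W {c z} → T ≤ size W * c → (∀ v → degree W v * c ≤ z) →
                    ∃[ W⁺ ] supDensity em G o W⁺ * T ≤ z
    supDensity*T≤ W {c} {z} T≤Nc degree*c≤z = W⁺ , (begin
      supDensity em G o W⁺ * T
        ≤⟨ *-monoʳ-≤ (m-nonNeg univ) (IsLUB.least (proj₂ (complete _ o _)) _ density≤) ⟩
      z * T ⁻¹ * T                     ≈⟨ x*y⁻¹*y≈x z T≉0 ⟩
      z                                ∎)
      where
      T≉0 = >⇒≉0 (0<T x₀)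
      N≉0 : ¬ (size W ≈ 0#)
      N≉0 N≈0 = <⇒≱ (0<T x₀) (≤-respʳ-≈ (trans (*-congʳ N≈0) (zeroˡ c)) T≤Nc)
      W⁺ : NonemptyFiniteSubset em G
      W⁺ = W , λ W≡[] → N≉0 (reflexive (≡.cong (fromℕ ∘ length) W≡[]))
      density≤ : ∀ i → density em G W (proj₁ i) ≤ z * T ⁻¹
      density≤ (v , _) = *-cancelʳ-≤ (0<T x₀) (begin
        density em G W v * T                   ≤⟨ *-monoˡ-≤ (0≤density em G W⁺ v) T≤Nc ⟩
        density em G W v * (size W * c)        ≈⟨ *-assoc _ _ _ ⟨
        density em G W v * size W * c          ≈⟨ *-congʳ (x*y⁻¹*y≈x _ N≉0) ⟩
        degree W v * c                         ≤⟨ degree*c≤z v ⟩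
        z                                      ≈⟨ x*y⁻¹*y≈x z T≉0 ⟨
        z * T ⁻¹ * T                           ∎)

  -- The upper bound: spreading vertices over small cells.

  module _ {h c ε : Carrier} (0<h : 0# < h) (0<c : 0# < c) (2h≈ε : h + h ≈ ε) where

    cell⊆ball : ∀ {x u v y} → v ~ u → Ball X h x u → Ball X h x y → Ball X (1# + ε) v y
    cell⊆ball {x} {u} {v} {y} v~u dxu<h dxy<h = begin-strict
      X.d v y                        ≤⟨ X.triangle v u y ⟩
      X.d v u + X.d u y              ≤⟨ +-monoʳ-≤ _ (X.triangle u x y) ⟩
      X.d v u + (X.d u x + X.d x y)
        <⟨ +-mono-<-≤ (adjacent⇒close v~u) (+-mono-≤ (≤-respˡ-≈ (d-sym x u) (proj₁ dxu<h)) (proj₁ dxy<h)) ⟩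
      1# + (h + h)                   ≈⟨ +-congˡ 2h≈ε ⟩
      1# + ε                         ∎

    -- Induction on the cell centres: the cell of `x` is what remains of R within `h` of `x`, and
    -- the rest of R goes to the later centres. The cells are thus disjoint, and their rounding
    -- errors of at most `c` add up.
    distribute : ∀ xs {R} (ρ : Borel X R) → (∀ y → R y → Any (λ x → X.d x y < h) xs) →
                 ∃[ W ] m ρ ≤ size W * c ×
                 (∀ v → degree W v * c ≤ m (∩-borel ρ (ball (1# + ε) v)) + fromℕ (length xs) * c)
    distribute [] ρ covered = none ,
      ≤-reflexive (trans (m-empty ρ λ y y∈R → ⊥-elim (¬Any[] (covered y y∈R))) (sym (zeroˡ c))) ,
      λ v → ≤-respˡ-≈ (+-identityˡ _) (+-monoˡ-≤ _ (m-nonNeg _))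
    distribute (x ∷ xs) {R} ρ covered
      with distribute xs (∩-borel ρ (complement (ball h x)))
             (λ y (y∈R , y∉ball) → Any.tail y∉ball (covered y y∈R))
         -- Rounding up keeps the total weight at least m(R) and exceeds the measure of the cell by
         -- at most `c`.
         | ceiling 0<c (m-nonNeg (∩-borel ρ (ball h x)))
    ... | W , mρ₂≤ , degree≤ | n , mρ₁≤nc , nc≤mρ₁+c with add-vertices x 0<h n W
    ...   | W′ , us , W′≡ , ∣us∣≡n , us-close = W′ , size≥ , degree≤′
      where
      ρ₁ = ∩-borel ρ (ball h x)
      ρ₂ = ∩-borel ρ (complement (ball h x))
      size≥ : m ρ ≤ size W′ * c
      size≥ = begin
        m ρ                                 ≈⟨ m-split ρ (ball h x) ⟩
        m ρ₁ + m ρ₂                         ≤⟨ +-mono-≤ mρ₁≤nc mρ₂≤ ⟩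
        fromℕ n * c + size W * c            ≈⟨ distribʳ c _ _ ⟨
        (fromℕ n + size W) * c              ≡⟨ ≡.cong (λ k → (fromℕ k + size W) * c) ∣us∣≡n ⟨
        (fromℕ (length us) + size W) * c    ≈⟨ *-congʳ (fromℕ-+ (length us) (length (elements W))) ⟨
        fromℕ (length us ℕ.+ length (elements W)) * c ≡⟨ ≡.cong (λ k → fromℕ k * c) (length-++ us) ⟨
        fromℕ (length (us ++ elements W)) * c ≡⟨ ≡.cong (λ ws → fromℕ (length ws) * c) W′≡ ⟨
        size W′ * c                         ∎
      degree≤′ : ∀ v → degree W′ v * c ≤ m (∩-borel ρ (ball (1# + ε) v)) + fromℕ (suc (length xs)) * c
      degree≤′ v = begin
        degree W′ v * c                              ≈⟨ *-congʳ (degree-++ {W} {W′} v W′≡) ⟩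
        (fromℕ (length (filter (adjacent? v) us)) + degree W v) * c ≈⟨ distribʳ c _ _ ⟩
        fromℕ (length (filter (adjacent? v) us)) * c + degree W v * c ≤⟨ +-mono-≤ new≤ (degree≤ v) ⟩
        (m (∩-borel ρ₁ B) + c) + (m (∩-borel ρ₂ B) + K)
          ≈⟨ solve 4 (λ p q r s → (p :+ q) :+ (r :+ s) := (p :+ r) :+ (s :+ q)) refl _ _ _ _ ⟩
        (m (∩-borel ρ₁ B) + m (∩-borel ρ₂ B)) + (K + c)
          ≈⟨ +-cong (m-split-∩ ρ (ball h x) B) (fromℕ-suc-* (length xs) c) ⟨
        m (∩-borel ρ B) + fromℕ (suc (length xs)) * c ∎
        where
        B = ball (1# + ε) v
        K = fromℕ (length xs) * c
        new≤ : fromℕ (length (filter (adjacent? v) us)) * c ≤ m (∩-borel ρ₁ B) + c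
        new≤ with em {P = Any (v ~_) us}
        ... | no  v≁us = begin
          fromℕ (length (filter (adjacent? v) us)) * c
            ≡⟨ ≡.cong (λ ws → fromℕ (length ws) * c) (filter-none (adjacent? v) (¬Any⇒All¬ us v≁us)) ⟩
          0# * c                               ≈⟨ zeroˡ c ⟩
          0#                                   ≤⟨ m-nonNeg _ ⟩
          m (∩-borel ρ₁ B)                     ≤⟨ x≤x+y _ (proj₁ 0<c) ⟩
          m (∩-borel ρ₁ B) + c                 ∎
        -- A single neighbour among the new vertices already puts the whole cell inside `B`, so all
        -- of `us` may be counted against the measure of the cell.
        ... | yes v~us with All.lookupAny us-close v~us
        ...   | dxu<h , v~u = begin
          fromℕ (length (filter (adjacent? v) us)) * c
            ≤⟨ *-monoʳ-≤ (proj₁ 0<c) (fromℕ-mono (length-filter (adjacent? v) us)) ⟩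
          fromℕ (length us) * c                ≡⟨ ≡.cong (λ k → fromℕ k * c) ∣us∣≡n ⟩
          fromℕ n * c                          ≤⟨ nc≤mρ₁+c ⟩
          m ρ₁ + c
            ≤⟨ +-monoˡ-≤ c (m-mono ρ₁ (∩-borel ρ₁ B) λ (y∈R , dxy<h) → (y∈R , dxy<h) , cell⊆ball v~u dxu<h dxy<h) ⟩
          m (∩-borel ρ₁ B) + c                 ∎

  -- Letting the errors tend to zero, and the value of α.

  module _ (o : Satisfiable V) (continuous : BallVolumeContinuousAt1 ud (proj₁ o)) where

    perturbed-volume : ∀ {η} → 0# < η → ∃[ ε ] 0# < ε × m (ball (1# + ε) (x₀ o)) ≤ b o + η
    perturbed-volume {η} 0<η =
      let δ , 0<δ , near = continuous η 0<η
          ε , 0<ε , ε≢0 , ∣ε∣<δ = small-rational 0<δ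
          0<1+ε = 0<+ 0<1 0<ε
      in fromℚ ε , 0<ε , (begin
        m (ball (1# + fromℚ ε) (x₀ o))               ≡⟨ ballVolume≡m 0<1+ε (x₀ o) ⟨
        ballVolume ud (1# + fromℚ ε) 0<1+ε (x₀ o)
          ≤⟨ ∣x-y∣≤⇒y≤x+ (proj₁ (near ε 0<1+ε ε≢0 ∣ε∣<δ)) ⟩
        ballVolume ud 1# 0<1 (x₀ o) + η              ≡⟨ ≡.cong (_+ η) (ballVolume≡m 0<1 (x₀ o)) ⟩
        b o + η                                      ∎)

    -- One `η` pays for enlarging the unit ball to radius 1 + ε, the other for rounding in the
    -- cells. Uniformity of the measure makes the bound the same for every `v`.
    sparse-subset : ∀ {η} → 0# < η → ∃[ W ] supDensity em G o W * T ≤ b o + (η + η)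
    sparse-subset {η} 0<η =
      let ε , 0<ε , b′≤b+η       = perturbed-volume 0<η
          h , 0<h , 2h≈ε         = half 0<ε
          -- `totallyBounded` covers by balls of twice its radius, hence the second halving.
          r , 0<r , 2r≈h         = half 0<h
          xs , covered           = totallyBounded (λ u → m-ball-equal 0<r u (x₀ o))
                                     (m-ball-positive 0<r (x₀ o))
          -- Chosen after the cells, so that the total rounding error is at most `η`; one is added
          -- to their number to keep the divisor nonzero.
          c , 0<c , [1+∣xs∣]c≈η   = fraction (length xs) 0<η
          W , T≤Nc , degree≤     = distribute 0<h 0<c 2h≈ε xs univ
                                     (λ y _ → Any.map (<-respʳ-≈ 2r≈h) (covered y))
      in supDensity*T≤ o W T≤Nc λ v → begin
        degree W v * c                                              ≤⟨ degree≤ v ⟩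
        m (∩-borel univ (ball (1# + ε) v)) + fromℕ (length xs) * c
          ≤⟨ +-mono-≤ (m-mono _ (ball (1# + ε) v) proj₂) (x≤x+y _ (proj₁ 0<c)) ⟩
        m (ball (1# + ε) v) + (fromℕ (length xs) * c + c)
          ≈⟨ +-congˡ (fromℕ-suc-* (length xs) c) ⟨
        m (ball (1# + ε) v) + fromℕ (suc (length xs)) * c
          ≈⟨ +-cong (m-ball-equal (0<+ 0<1 0<ε) v (x₀ o)) [1+∣xs∣]c≈η ⟩
        m (ball (1# + ε) (x₀ o)) + η                                ≤⟨ +-monoˡ-≤ η b′≤b+η ⟩
        b o + η + η                                                 ≈⟨ +-assoc _ _ _ ⟩
        b o + (η + η)                                               ∎

    α*T≤b : α em G o * T ≤ b o
    α*T≤b = ≤-fromAbove λ η 0<η →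
      let ½η , 0<½η , 2½η≈η = half 0<η
          W , sup≤          = sparse-subset 0<½η
      in ≤-respʳ-≈ (+-congˡ 2½η≈η) (≤-trans (α*T≤supDensity*T o W) sup≤)

    -- The two bounds give α T = b, with b measured at the base vertex. Uniformity replaces b by the
    -- measure of the unit ball at `x`, and dividing by it gives α Vl = 1.
    α≈1/Vl : ∀ x → α em G o ≈ 1/⁺ (Vl ud x)
    α≈1/Vl x = trans (⁻¹-unique Vl≉0 α*Vl≈1) (reflexive (≡.sym 1/Vl≡))
      where
      bₓ = m (ball 1# x)
      0<bₓ = m-ball-positive 0<1 x
      bₓ≉0 = >⇒≉0 0<bₓ
      1/Vl≡ : 1/⁺ (Vl ud x) ≡ (T * bₓ ⁻¹) ⁻¹
      1/Vl≡ = ≡.cong₂ (λ s y → 1/⁺ (s /⁺ y)) (μ≡m univ) (ballVolume≡m 0<1 x)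
      Vl≉0 : ¬ (T * bₓ ⁻¹ ≈ 0#)
      Vl≉0 = >⇒≉0 (0<* (0<T x) (0<⁻¹ 0<bₓ))
      α*Vl≈1 : α em G o * (T * bₓ ⁻¹) ≈ 1#
      α*Vl≈1 = begin-equality
        α em G o * (T * bₓ ⁻¹)  ≈⟨ *-assoc _ _ _ ⟨
        α em G o * T * bₓ ⁻¹    ≈⟨ *-congʳ (antisym α*T≤b (b≤α*T o)) ⟩
        b o * bₓ ⁻¹             ≈⟨ *-congʳ (m-ball-equal 0<1 (x₀ o) x) ⟩
        bₓ * bₓ ⁻¹              ≈⟨ *-inverseʳ bₓ≉0 ⟩
        1#                      ∎

theorem4p8 : (em : ∀ {ℓ} → ExcludedMiddle ℓ)
    (ℝ : CompleteOrderedField) (X : MetricSpace ℝ) →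
    (let open CompleteOrderedField ℝ) →
    Separable X → NoIsolatedPoints X →
    (M : BorelMeasure X) (ud : IsUniformlyDistributed M) → μX M <⁺ ⊤⁺ →
    (G : Graph X) (dense : Dense X (Graph.V G)) → IsGEC X G →
    (∀ x → Graph.V G x → BallVolumeContinuousAt1 ud x) →
    HasFiniteVCDimension X (perturbedUnitBalls X (Graph.V G)) →
    ∀ x → α em G (dense⇒satisfiable X dense x) ≈ 1/⁺ (Vl ud x)
theorem4p8 em ℝ X _ _ M ud μX<∞ G dense gec continuous _ x =
  GECDensity.α≈1/Vl em ud μX<∞ dense gec o (continuous _ (proj₂ o)) x
  where o = dense⇒satisfiable X dense x
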